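{- Let $N\ge9$, $\alpha\in\{2,3,4\}$ with $\alpha\mid N$, and $M_\alpha=N/\alpha$. Let $g$ be a $2\times5$ matrix over $\mathbb{Z}_N$ generating an admissible linear code, with columns indexed by $i=0,\dots,4$ and $\gcd_i=\gcd(g_{1i},g_{2i},N)$. Suppose exactly one column of $g$ has $\gcd_i=M_\alpha$ and the other columns have $\gcd_i<M_\alpha$. Then $g$ does not generate a thin linear code, unless $g$ has a column of zeros.
   Context: $\mathbb{Z}_N=\mathbb{Z}/N\mathbb{Z}$; its elements are identified with the representatives $0,1,\dots,N-1$, and gcd's are taken of these integers. The code generated by $g$ is the submodule of $\mathbb{Z}_N^5$ generated by the rows of $g$. A linear code is extended if every word has coordinate sum $0\bmod N$; call it admissible if it is extended and the greatest common divisor of $N$ and all entries of all words (equivalently of $N$ and all entries of $g$) is $1$. An extended code is thin if it contains no word all of whose entries are nonzero. -}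

module Defs where

open import Data.Fin.Base using (Fin; zero; suc; toℕ)
open import Data.Nat.Base using (ℕ; NonZero; _+_; _*_)
open import Data.Nat.DivMod using (_mod_)
open import Data.Nat.Divisibility using (_∣_)
open import Data.Nat.GCD using (gcd)
open import Data.Product.Base using (_×_; ∃-syntax)
open import Data.Sum.Base using (_⊎_)
open import Data.Vec.Base using (Vec; lookup; map; replicate; sum; zipWith)
open import Level using (0ℓ)
open import Relation.Binary.PropositionalEquality using (_≡_; _≢_)
open import Relation.Nullary.Negation using (¬_)
open import Relation.Unary using (Pred; _∈_)

-- The ring ℤ/Nℤ, each class being given by its representative in 0,…,N-1.
-- `toℕ` is the identification of a class with that representative.

ℤmod : ℕ → Set
ℤmod = Fin

module _ {N : ℕ} .{{_ : NonZero N}} where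

  0ₙ : ℤmod N
  0ₙ = 0 mod N

  infixl 6 _+ₙ_
  infixl 7 _*ₙ_

  _+ₙ_ : ℤmod N → ℤmod N → ℤmod N
  x +ₙ y = (toℕ x + toℕ y) mod N

  _*ₙ_ : ℤmod N → ℤmod N → ℤmod N
  x *ₙ y = (toℕ x * toℕ y) mod N

-- `Vec` rather than functions `Fin n → ℤmod N`, so that _≡_ on vectors is
-- coordinatewise equality.

record LinearCode (N n : ℕ) .{{_ : NonZero N}} : Set₁ where
  field
    Word     : Pred (Vec (ℤmod N) n) 0ℓ
    0-closed : replicate n 0ₙ ∈ Word
    +-closed : ∀ {v w} → v ∈ Word → w ∈ Word → zipWith _+ₙ_ v w ∈ Word
    *-closed : ∀ c {w} → w ∈ Word → map (c *ₙ_) w ∈ Word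

open LinearCode public using (Word)

-- Matrices are vectors of rows.

Matrix : (N m n : ℕ) → Set
Matrix N m n = Vec (Vec (ℤmod N) n) m

entry : ∀ {N m n} → Matrix N m n → Fin m → Fin n → ℤmod N
entry g k i = lookup (lookup g k) i

module _ {N m n : ℕ} .{{_ : NonZero N}} where

  -- The smallest submodule of (ℤ/Nℤ)ⁿ containing the rows of g.

  data Span (g : Matrix N m n) : Pred (Vec (ℤmod N) n) 0ℓ where
    row   : ∀ k → Span g (lookup g k)
    zero  : Span g (replicate n 0ₙ)
    plus  : ∀ {v w} → Span g v → Span g w → Span g (zipWith _+ₙ_ v w)
    scale : ∀ c {w} → Span g w → Span g (map (c *ₙ_) w)

  codeGeneratedBy : Matrix N m n → LinearCode N n
  codeGeneratedBy g = record
    { Word     = Span g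
    ; 0-closed = zero
    ; +-closed = plus
    ; *-closed = scale
    }

  ZeroColumn : Matrix N m n → Fin n → Set
  ZeroColumn g i = ∀ k → entry g k i ≡ 0ₙ

-- `IsGCD P d`: d is the greatest common divisor of the set P of natural numbers.

IsGCD : Pred ℕ 0ℓ → ℕ → Set
IsGCD P d = (∀ {x} → x ∈ P → d ∣ x) × (∀ {c} → (∀ {x} → x ∈ P → c ∣ x) → c ∣ d)

module _ {N n : ℕ} .{{_ : NonZero N}} where

  ModulusOrEntry : LinearCode N n → Pred ℕ 0ℓ
  ModulusOrEntry C x =
    x ≡ N ⊎ (∃[ w ] ∃[ i ] w ∈ Word C × x ≡ toℕ (lookup w i))

  Extended : LinearCode N n → Set
  Extended C = ∀ {w} → w ∈ Word C → N ∣ sum (map toℕ w)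

  record Admissible (C : LinearCode N n) : Set where
    field
      extended : Extended C
      gcd≡1    : IsGCD (ModulusOrEntry C) 1

  record Thin (C : LinearCode N n) : Set where
    field
      extended      : Extended C
      noNowhereZero : ∀ {w} → w ∈ Word C → ¬ (∀ i → lookup w i ≢ 0ₙ)

columnGCD : ∀ {N n} → Matrix N 2 n → Fin n → ℕ
columnGCD {N} g i =
  gcd (gcd (toℕ (entry g zero i)) (toℕ (entry g (suc zero) i))) N

-- View the columns as linear forms c on (ℤ/N)², of orders k(c) = N / gcd(c): a thin
-- code is one where the kernels of the forms cover (ℤ/N)². On a coset C of the
-- kernel of the distinguished form c₀, on which c₀ generates its image, c₀ does not
-- vanish, while each other form c vanishes on a proportion 0 or 1/k(c) of C. Hence
-- the four other orders, all > α, satisfy Σ 1/k ≥ 1. This excludes α = 4, and for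
-- α = 3 forces all four orders to be 4. As the forms sum to zero, every order
-- divides the lcm of the others, and this lcm is a multiple of N ≥ 9, so for α = 3
-- this is absurd and for α = 2 only the orders (3,3,4,4), (3,4,4,6) and (3,3,4,12)
-- remain. In the first two one kernel contains another, so that three of the four
-- already cover C; in the last two of the kernels overlap on C although Σ 1/k = 1.

module Submission where

open import Defs
open import Data.Empty using (⊥)
open import Data.Fin.Base using (Fin; zero; suc; toℕ; punchIn)
open import Data.Fin.Properties using (_≟_; toℕ<n; toℕ-injective; toℕ-fromℕ<; punchInᵢ≢i; ¬∀⟶∃¬)
  renaming (suc-injective to Fin-suc-injective)
open import Data.List.Base using (List; []; _∷_; _++_; length; map; tabulate)
open import Data.List.Relation.Binary.Permutation.Propositional using (_↭_; ↭-refl; ↭-sym; prep)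
open import Data.List.Relation.Binary.Permutation.Propositional.Properties
  using (shift; map⁺; All-resp-↭; Any-resp-↭; ↭-length)
open import Data.List.Relation.Binary.Pointwise.Base using (Pointwise; []; _∷_)
open import Data.List.Relation.Unary.All as All using (All; []; _∷_)
import Data.List.Relation.Unary.All.Properties as All
open import Data.List.Relation.Unary.Any using (Any; here; there)
import Data.List.Relation.Unary.Any.Properties as Any
open import Data.List.Relation.Unary.Linked using ([-]; _∷_)
import Data.List.Relation.Unary.Sorted.TotalOrder
import Data.List.Sort
open import Data.Nat.Base
open import Data.Nat.Divisibility
open import Data.Nat.DivMod
  using (_mod_; m%n<n; m%n%n≡m%n; %-distribˡ-+; %-distribˡ-*)
open import Data.Nat.GCD using (gcd; gcd[m,n]∣m; gcd[m,n]∣n; gcd-GCD; gcd-greatest;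
  c*gcd[m,n]≡gcd[cm,cn]; module Bézout)
open import Data.Nat.ListAction using (sum)
open import Data.Nat.ListAction.Properties using (sum-↭)
open import Data.Nat.Properties hiding (_≟_)
open import Data.Nat.Tactic.RingSolver using (solve-∀)
open import Data.Product.Base using (_×_; _,_; proj₂; ∃-syntax)
open import Data.Sum.Base as Sum using (_⊎_; inj₁; inj₂; [_,_]′)
open import Data.Vec.Base as Vec using ([]; _∷_; lookup)
open import Data.Vec.Properties using (lookup-map; lookup-replicate; lookup-zipWith)
open import Function.Base using (_∘_)
open import Function.Bundles using (_⇔_; mk⇔; Equivalence)
open import Relation.Binary.Bundles using (DecTotalOrder)
import Relation.Binary.Construct.On as On
open import Relation.Binary.PropositionalEquality
open import Relation.Nullary using (¬_; Dec; yes; no; contradiction)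
open import Relation.Nullary.Decidable
  using (True; False; toWitness; toWitnessFalse; decidable-stable; ¬?; _×-dec_)

open import Algebra.Properties.CommutativeMonoid.Sum +-0-commutativeMonoid
  using (sum-syntax; ∑-distrib-+; sum-cong-≗; sum-replicate-zero)

∑-mono : ∀ {n} {f g : Fin n → ℕ} → (∀ i → f i ≤ g i) → ∑[ i < n ] f i ≤ ∑[ i < n ] g i
∑-mono {zero}  f≤g = z≤n
∑-mono {suc n} f≤g = +-mono-≤ (f≤g zero) (∑-mono (f≤g ∘ suc))

∑-const : ∀ n m → ∑[ _ < n ] m ≡ n * m
∑-const zero    m = refl
∑-const (suc n) m = cong (m +_) (∑-const n m)

∑-nonZero : ∀ {n} (f : Fin n → ℕ) → ∑[ i < n ] f i ≡ 0 ⊎ ∃[ i ] f i ≢ 0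
∑-nonZero {zero}  f = inj₁ refl
∑-nonZero {suc n} f with f zero in eq | ∑-nonZero (f ∘ suc)
... | zero  | inj₁ ∑≡0       = inj₁ ∑≡0
... | zero  | inj₂ (i , f≢0) = inj₂ (suc i , f≢0)
... | suc m | _              = inj₂ (zero , λ f≡0 → 1+n≢0 (trans (sym eq) f≡0))

∑-telescope : ∀ (f : ℕ → ℕ) n →
              f 0 + ∑[ i < n ] f (suc (toℕ i)) ≡ ∑[ i < n ] f (toℕ i) + f n
∑-telescope f zero    = +-comm (f 0) 0
∑-telescope f (suc n) =
  trans (cong (f 0 +_) (∑-telescope (f ∘ suc) n)) (sym (+-assoc (f 0) _ _))

∑-periodic : ∀ {n} (f : ℕ → ℕ) → (∀ a → f (n + a) ≡ f a) →
             ∀ s → ∑[ i < n ] f (s + toℕ i) ≡ ∑[ i < n ] f (toℕ i)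
∑-periodic     f per zero    = refl
∑-periodic {n} f per (suc s) = trans
  (∑-periodic (f ∘ suc)
    (λ a → trans (cong f (sym (+-suc n a))) (per (suc a))) s)
  (+-cancelˡ-≡ (f 0) _ _ (begin
    f 0 + ∑[ i < n ] f (suc (toℕ i))  ≡⟨ ∑-telescope f n ⟩
    ∑[ i < n ] f (toℕ i) + f n        ≡⟨ +-comm _ (f n) ⟩
    f n + ∑[ i < n ] f (toℕ i)        ≡⟨ cong (λ m → f m + ∑[ i < n ] f (toℕ i)) (+-identityʳ n) ⟨
    f (n + 0) + ∑[ i < n ] f (toℕ i)  ≡⟨ cong (_+ ∑[ i < n ] f (toℕ i)) (per 0) ⟩
    f 0 + ∑[ i < n ] f (toℕ i)        ∎))
  where open ≡-Reasoning

𝟙 : ∀ {P : Set} → Dec P → ℕ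
𝟙 (yes _) = 1
𝟙 (no _)  = 0

𝟙-cong : ∀ {P Q : Set} → P ⇔ Q → (P? : Dec P) (Q? : Dec Q) → 𝟙 P? ≡ 𝟙 Q?
𝟙-cong P⇔Q (yes p) (yes q) = refl
𝟙-cong P⇔Q (no ¬p) (no ¬q) = refl
𝟙-cong P⇔Q (yes p) (no ¬q) = contradiction (Equivalence.to P⇔Q p) ¬q
𝟙-cong P⇔Q (no ¬p) (yes q) = contradiction (Equivalence.from P⇔Q q) ¬p

𝟙≢0 : ∀ {P : Set} (P? : Dec P) → 𝟙 P? ≢ 0 → P
𝟙≢0 (yes p) _   = p
𝟙≢0 (no _)  0≢0 = contradiction refl 0≢0

𝟙-yes : ∀ {P : Set} (P? : Dec P) → P → 𝟙 P? ≡ 1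
𝟙-yes (yes _) _ = refl
𝟙-yes (no ¬p) p = contradiction p ¬p

∑𝟙≤𝟙 : ∀ {n} {P : Fin n → Set} {Q : Set} (P? : ∀ i → Dec (P i)) (Q? : Dec Q) →
        (∀ i → P i → Q) → (∀ i j → P i → P j → i ≡ j) → ∑[ i < n ] 𝟙 (P? i) ≤ 𝟙 Q?
∑𝟙≤𝟙 {zero}  P? Q? P⇒Q unique = z≤n
∑𝟙≤𝟙 {suc n} P? Q? P⇒Q unique with P? zero
... | no _  = ∑𝟙≤𝟙 (P? ∘ suc) Q? (P⇒Q ∘ suc)
                (λ i j pᵢ pⱼ → Fin-suc-injective (unique (suc i) (suc j) pᵢ pⱼ))
... | yes p with ∑-nonZero (λ i → 𝟙 (P? (suc i)))
...   | inj₁ ∑≡0 = ≤-reflexive (trans (cong suc ∑≡0) (sym (𝟙-yes Q? (P⇒Q zero p))))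
...   | inj₂ (i , ≢0) = contradiction (unique zero (suc i) p (𝟙≢0 (P? (suc i)) ≢0)) λ ()

at : ∀ {k l m} → k ≡ l → {True (l ∣? m)} → k ∣ m
at refl {l∣m} = toWitness l∣m

not-at : ∀ {k l m} → k ≡ l → {False (l ∣? m)} → ¬ k ∣ m
not-at refl {l∤m} = toWitnessFalse l∤m

≤-split : ∀ {m n} → m ≤ n → suc m ≤ n ⊎ n ≡ m
≤-split m≤n = Sum.map₂ sym (m≤n⇒m<n∨m≡n m≤n)

∣∧<2*⇒≡ : ∀ {d n} .{{_ : NonZero n}} → d ∣ n → n < 2 * d → n ≡ d
∣∧<2*⇒≡ {d} {n} (divides zero          n≡0)  n<2d = contradiction n≡0 (≢-nonZero⁻¹ n)
∣∧<2*⇒≡ {d} {n} (divides (suc zero)    n≡d)  n<2d = trans n≡d (*-identityˡ d)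
∣∧<2*⇒≡ {d} {n} (divides (suc (suc q)) n≡qd) n<2d =
  contradiction (subst (2 * d ≤_) (sym n≡qd) (*-monoˡ-≤ d (s≤s (s≤s (z≤n {q}))))) (<⇒≱ n<2d)

data Point : Set where
  point : ℕ → ℕ → Point

infixl 6 _⊕_
infixr 7 _⊙_

_⊕_ : Point → Point → Point
point a b ⊕ point a′ b′ = point (a + a′) (b + b′)

_⊙_ : ℕ → Point → Point
m ⊙ point a b = point (m * a) (m * b)

-- A column (x , y) of a generator matrix, seen as the linear form sending the
-- coefficients (a , b) of a combination of the rows to an entry of that word.

⟨_,_⟩ : Point → Point → ℕ
⟨ point x y , point a b ⟩ = a * x + b * y

⟨⟩-⊕ : ∀ c u v → ⟨ c , u ⊕ v ⟩ ≡ ⟨ c , u ⟩ + ⟨ c , v ⟩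
⟨⟩-⊕ (point x y) (point a b) (point a′ b′) = eq x y a b a′ b′
  where
  eq : ∀ x y a b a′ b′ → (a + a′) * x + (b + b′) * y ≡ (a * x + b * y) + (a′ * x + b′ * y)
  eq = solve-∀

⟨⟩-⊙ : ∀ c m u → ⟨ c , m ⊙ u ⟩ ≡ m * ⟨ c , u ⟩
⟨⟩-⊙ (point x y) m (point a b) = eq x y m a b
  where
  eq : ∀ x y m a b → (m * a) * x + (m * b) * y ≡ m * (a * x + b * y)
  eq = solve-∀

∣⟨⟩ : ∀ {d} x y → d ∣ x → d ∣ y → ∀ u → d ∣ ⟨ point x y , u ⟩
∣⟨⟩ x y d∣x d∣y (point a b) = ∣m∣n⇒∣m+n (∣n⇒∣m*n a d∣x) (∣n⇒∣m*n b d∣y)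

∣-cong-+ˡ : ∀ {d k l} m → d ∣ k + l → d ∣ m * k → d ∣ m * l
∣-cong-+ˡ {d} {k} {l} m d∣k+l d∣mk =
  ∣m+n∣m⇒∣n (subst (d ∣_) (*-distribˡ-+ m k l) (∣n⇒∣m*n m d∣k+l)) d∣mk

-- ℓ₁⋯ℓᵣ, and ℓ₁⋯ℓᵣ (1/ℓ₁ + ⋯ + 1/ℓᵣ)

den num : List ℕ → ℕ
den []       = 1
den (l ∷ ls) = l * den ls
num []       = 0
num (l ∷ ls) = den ls + l * num ls

den*sum≤num* : ∀ {t ls ns} → Pointwise (λ l n → l * n ≤ t) ls ns →
               den ls * sum ns ≤ num ls * t
den*sum≤num* []                               = z≤n
den*sum≤num* {t} {l ∷ ls} {n ∷ ns} (ln≤t ∷ p) = begin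
  l * den ls * (n + sum ns)     ≡⟨ eq l (den ls) n (sum ns) ⟩
  den ls * (l * n) + l * (den ls * sum ns)
    ≤⟨ +-mono-≤ (*-monoʳ-≤ (den ls) ln≤t) (*-monoʳ-≤ l (den*sum≤num* p)) ⟩
  den ls * t + l * (num ls * t) ≡⟨ eq′ l (den ls) (num ls) t ⟩
  (den ls + l * num ls) * t     ∎
  where
  open ≤-Reasoning
  eq : ∀ l d n s → l * d * (n + s) ≡ d * (l * n) + l * (d * s)
  eq = solve-∀
  eq′ : ∀ l d m t → d * t + l * (m * t) ≡ (d + l * m) * t
  eq′ = solve-∀

num<den⇒sum< : ∀ {t ls ns} → 0 < t → Pointwise (λ l n → l * n ≤ t) ls ns →
                num ls < den ls → sum ns < t
num<den⇒sum< {t} {ls} {ns} 0<t p num<den = *-cancelˡ-< (den ls) _ _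
  (≤-<-trans (den*sum≤num* p) (*-monoˡ-< t {{>-nonZero 0<t}} num<den))

num≤den⇒sum≤ : ∀ {t ls ns} → .{{NonZero (den ls)}} → Pointwise (λ l n → l * n ≤ t) ls ns →
                num ls ≤ den ls → sum ns ≤ t
num≤den⇒sum≤ {t} {ls} {ns} p num≤den = *-cancelˡ-≤ (den ls)
  (≤-trans (den*sum≤num* p) (*-monoˡ-≤ t num≤den))

-- Modulo N the negative coefficient in Bézout's identity becomes a natural number.

bézout : ∀ N {m n} → .{{NonZero N}} → ∃[ a ] ∃[ b ] N ∣ a * m + b * n + gcd m n
bézout N {m} {n} with Bézout.identity (gcd-GCD m n)
... | Bézout.+- s t eq = pred N * s , t , divides (s * m) (begin
  pred N * s * m + t * n + gcd m n     ≡⟨ lem (pred N) s m (t * n) (gcd m n) ⟩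
  pred N * (s * m) + (gcd m n + t * n) ≡⟨ cong (pred N * (s * m) +_) eq ⟩
  pred N * (s * m) + s * m             ≡⟨ +-comm _ (s * m) ⟩
  suc (pred N) * (s * m)               ≡⟨ cong (_* (s * m)) (suc-pred N) ⟩
  N * (s * m)                          ≡⟨ *-comm N (s * m) ⟩
  s * m * N                            ∎)
  where
  open ≡-Reasoning
  lem : ∀ p s m t g → p * s * m + t + g ≡ p * (s * m) + (g + t)
  lem = solve-∀
... | Bézout.-+ s t eq = s , pred N * t , divides (t * n) (begin
  s * m + pred N * t * n + gcd m n     ≡⟨ lem (pred N) t n (s * m) (gcd m n) ⟩
  pred N * (t * n) + (gcd m n + s * m) ≡⟨ cong (pred N * (t * n) +_) eq ⟩
  pred N * (t * n) + t * n             ≡⟨ +-comm _ (t * n) ⟩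
  suc (pred N) * (t * n)               ≡⟨ cong (_* (t * n)) (suc-pred N) ⟩
  N * (t * n)                          ≡⟨ *-comm N (t * n) ⟩
  t * n * N                            ∎)
  where
  open ≡-Reasoning
  lem : ∀ p s m t g → t + p * s * m + g ≡ p * (s * m) + (g + t)
  lem = solve-∀

module _ (N : ℕ) .{{_ : NonZero N}} where

  columnGcd : Point → ℕ
  columnGcd (point x y) = gcd (gcd x y) N

  -- The order of the form u ↦ ⟨ c , u ⟩ modulo N.

  order : Point → ℕ
  order (point x y) = quotient (gcd[m,n]∣n (gcd x y) N)

  order*columnGcd : ∀ c → N ≡ order c * columnGcd c
  order*columnGcd (point x y) = m∣n⇒n≡quotient*m (gcd[m,n]∣n (gcd x y) N)

  columnGcd-nonZero : ∀ c → NonZero (columnGcd c)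
  columnGcd-nonZero c = ≢-nonZero λ d≡0 → ≢-nonZero⁻¹ N
    (trans (order*columnGcd c) (trans (cong (order c *_) d≡0) (*-zeroʳ (order c))))

  columnGcd∣⟨⟩ : ∀ c u → columnGcd c ∣ ⟨ c , u ⟩
  columnGcd∣⟨⟩ (point x y) = ∣⟨⟩ x y (∣-trans d∣g (gcd[m,n]∣m x y)) (∣-trans d∣g (gcd[m,n]∣n x y))
    where d∣g = gcd[m,n]∣m (gcd x y) N

  columnGcd-attained : ∀ c → ∃[ u ] N ∣ columnGcd c + ⟨ c , u ⟩
  columnGcd-attained c@(point x y)
    with a , b , N∣s+g ← bézout N {x} {y}
       | a′ , b′ , N∣r ← bézout N {gcd x y} {N} =
    u , ∣m+n∣m⇒∣n (subst (N ∣_) identity N∣lhs) (m∣m*n (a′ * gcd x y))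
    where
    u = (pred N * a′) ⊙ point a b
    g = gcd x y
    s = a * x + b * y
    rearrange : ∀ t l d → t + l + d ≡ l + (t + d)
    rearrange = solve-∀
    N∣a′g+d : N ∣ a′ * g + columnGcd c
    N∣a′g+d = ∣m+n∣m⇒∣n (subst (N ∣_) (rearrange (a′ * g) (b′ * N) _) N∣r) (n∣m*n b′)
    N∣lhs : N ∣ pred N * a′ * (s + g) + (a′ * g + columnGcd c)
    N∣lhs = ∣m∣n⇒∣m+n (∣n⇒∣m*n (pred N * a′) N∣s+g) N∣a′g+d
    eq : ∀ p a′ s g d → p * a′ * (s + g) + (a′ * g + d) ≡ suc p * (a′ * g) + (d + p * a′ * s)
    eq = solve-∀
    identity : pred N * a′ * (s + g) + (a′ * g + columnGcd c) ≡
               N * (a′ * g) + (columnGcd c + ⟨ c , u ⟩)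
    identity = trans (eq (pred N) a′ s g (columnGcd c))
      (cong₂ (λ n t → n * (a′ * g) + (columnGcd c + t))
        (suc-pred N) (sym (⟨⟩-⊙ c (pred N * a′) (point a b))))

  order∣⇒kills : ∀ m c → order c ∣ m → ∀ u → N ∣ m * ⟨ c , u ⟩
  order∣⇒kills m c k∣m u = subst (_∣ m * ⟨ c , u ⟩) (sym (order*columnGcd c))
    (*-pres-∣ k∣m (columnGcd∣⟨⟩ c u))

  kills⇒order∣ : ∀ {m u} c → N ∣ columnGcd c + ⟨ c , u ⟩ → N ∣ m * ⟨ c , u ⟩ → order c ∣ m
  kills⇒order∣ {m} {u} c N∣d+cu N∣mcu = *-cancelʳ-∣ (columnGcd c) {{columnGcd-nonZero c}}
    (subst (_∣ m * columnGcd c) (order*columnGcd c)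
      (∣-cong-+ˡ m (subst (N ∣_) (+-comm (columnGcd c) _) N∣d+cu) N∣mcu))

  Zero : Point → Point → Set
  Zero c u = N ∣ ⟨ c , u ⟩

  ∣+⟨⟩-shift : ∀ k c {v} → Zero c v → ∀ u → N ∣ k + ⟨ c , v ⊕ u ⟩ ⇔ N ∣ k + ⟨ c , u ⟩
  ∣+⟨⟩-shift k c {v} N∣cv u = mk⇔
    (λ h → ∣m+n∣m⇒∣n (subst (N ∣_) eq h) N∣cv)
    (λ h → subst (N ∣_) (sym eq) (∣m∣n⇒∣m+n N∣cv h))
    where
    rearrange : ∀ k l m → k + (l + m) ≡ l + (k + m)
    rearrange = solve-∀
    eq : k + ⟨ c , v ⊕ u ⟩ ≡ ⟨ c , v ⟩ + (k + ⟨ c , u ⟩)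
    eq = trans (cong (k +_) (⟨⟩-⊕ c v u)) (rearrange k ⟨ c , v ⟩ _)

  Zero-⊙ : ∀ m c {v} → N ∣ m * ⟨ c , v ⟩ → Zero c (m ⊙ v)
  Zero-⊙ m c {v} = subst (N ∣_) (sym (⟨⟩-⊙ c m v))

  Zero-N⊙ : ∀ c v → Zero c (N ⊙ v)
  Zero-N⊙ c v = Zero-⊙ N c {v} (m∣m*n ⟨ c , v ⟩)

  S : (Point → ℕ) → ℕ
  S f = ∑[ i < N ] ∑[ j < N ] f (point (toℕ i) (toℕ j))

  Periodic : (Point → ℕ) → Set
  Periodic f = ∀ u v → f (N ⊙ v ⊕ u) ≡ f u

  S-mono : ∀ {f g} → (∀ u → f u ≤ g u) → S f ≤ S g
  S-mono f≤g = ∑-mono {N} λ i → ∑-mono {N} λ j → f≤g (point (toℕ i) (toℕ j))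

  S-+ : ∀ f g → S (λ u → f u + g u) ≡ S f + S g
  S-+ f g = trans
    (sum-cong-≗ {N} λ i → ∑-distrib-+ {N}
      (λ j → f (point (toℕ i) (toℕ j))) (λ j → g (point (toℕ i) (toℕ j))))
    (∑-distrib-+ {N}
      (λ i → ∑[ j < N ] f (point (toℕ i) (toℕ j))) (λ i → ∑[ j < N ] g (point (toℕ i) (toℕ j))))

  S-0 : S (λ _ → 0) ≡ 0
  S-0 = trans (sum-cong-≗ {N} λ _ → sum-replicate-zero N) (sum-replicate-zero N)

  S-sum : ∀ (f : Point → Point → ℕ) cs →
          S (λ u → sum (map (λ c → f c u) cs)) ≡ sum (map (λ c → S (f c)) cs)
  S-sum f []       = S-0
  S-sum f (c ∷ cs) =
    trans (S-+ (f c) (λ u → sum (map (λ c → f c u) cs))) (cong (S (f c) +_) (S-sum f cs))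

  S-∑ : ∀ k (f : ℕ → Point → ℕ) → S (λ u → ∑[ i < k ] f (toℕ i) u) ≡ ∑[ i < k ] S (f (toℕ i))
  S-∑ zero    f = S-0
  S-∑ (suc k) f =
    trans (S-+ (f 0) (λ u → ∑[ i < k ] f (suc (toℕ i)) u)) (cong (S (f 0) +_) (S-∑ k (f ∘ suc)))

  S-shift : ∀ {f} → Periodic f → ∀ v → S (f ∘ (v ⊕_)) ≡ S f
  S-shift {f} per (point s t) = trans
    (sum-cong-≗ {N} λ i → ∑-periodic {N} (λ b → f (point (s + toℕ i) b)) (perʳ (s + toℕ i)) t)
    (∑-periodic {N} (λ a → ∑[ j < N ] f (point a (toℕ j)))
      (λ a → sum-cong-≗ {N} λ j → perˡ (toℕ j) a) s)
    where
    perˡ : ∀ b a → f (point (N + a) b) ≡ f (point a b)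
    perˡ b a = trans
      (cong₂ (λ m n → f (point (m + a) (n + b))) (sym (*-identityʳ N)) (sym (*-zeroʳ N)))
      (per (point a b) (point 1 0))
    perʳ : ∀ a b → f (point a (N + b)) ≡ f (point a b)
    perʳ a b = trans
      (cong₂ (λ m n → f (point (m + a) (n + b))) (sym (*-zeroʳ N)) (sym (*-identityʳ N)))
      (per (point a b) (point 0 1))

  S-nonZero : ∀ f → S f ≡ 0 ⊎ ∃[ u ] f u ≢ 0
  S-nonZero f with ∑-nonZero {N} (λ i → ∑[ j < N ] f (point (toℕ i) (toℕ j)))
  ... | inj₁ S≡0 = inj₁ S≡0
  ... | inj₂ (i , ∑≢0) with ∑-nonZero {N} (λ j → f (point (toℕ i) (toℕ j)))
  ...   | inj₁ ∑≡0       = contradiction ∑≡0 ∑≢0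
  ...   | inj₂ (j , f≢0) = inj₂ (point (toℕ i) (toℕ j) , f≢0)

  0<S : ∀ {f u} → Periodic f → 0 < f u → 0 < S f
  0<S {f} {u@(point _ _)} per 0<fu = subst (0 <_) (S-shift per u)
    (≤-trans
      (subst (0 <_) (cong₂ (λ a b → f (point a b)) (sym (+-identityʳ _)) (sym (+-identityʳ _))) 0<fu)
      (≤-trans (0∈ N λ j → f (u ⊕ point 0 j)) (0∈ N λ i → ∑[ j < N ] f (u ⊕ point i (toℕ j)))))
    where
    0∈ : ∀ n .{{_ : NonZero n}} (h : ℕ → ℕ) → h 0 ≤ ∑[ i < n ] h (toℕ i)
    0∈ (suc n) h = m≤m+n (h 0) _

  Shiftable : (Point → Set) → Set
  Shiftable P = ∀ v u → P (N ⊙ v ⊕ u) ⇔ P u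

  𝟙-periodic : ∀ {P : Point → Set} (P? : ∀ u → Dec (P u)) → Shiftable P → Periodic (λ u → 𝟙 (P? u))
  𝟙-periodic P? shiftable u v = 𝟙-cong (shiftable v u) (P? _) (P? _)

  shiftable-× : ∀ {P Q} → Shiftable P → Shiftable Q → Shiftable (λ u → P u × Q u)
  shiftable-× sP sQ v u = mk⇔
    (λ (p , q) → Equivalence.to (sP v u) p , Equivalence.to (sQ v u) q)
    (λ (p , q) → Equivalence.from (sP v u) p , Equivalence.from (sQ v u) q)

  shiftable-∣ : ∀ k c → Shiftable (λ u → N ∣ k + ⟨ c , u ⟩)
  shiftable-∣ k c v = ∣+⟨⟩-shift k c {N ⊙ v} (Zero-N⊙ c v)

  Zero? : ∀ c u → Dec (Zero c u)
  Zero? c u = N ∣? ⟨ c , u ⟩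

  module _ (c₀ : Point) where

    -- The coset on which the form c₀ takes the value - columnGcd c₀ modulo N,
    -- a generator of the image of c₀.

    Coset : Point → Set
    Coset u = N ∣ columnGcd c₀ + ⟨ c₀ , u ⟩

    Coset? : ∀ u → Dec (Coset u)
    Coset? u = N ∣? columnGcd c₀ + ⟨ c₀ , u ⟩

    CosetZero? : ∀ c u → Dec (Coset u × Zero c u)
    CosetZero? c u = Coset? u ×-dec Zero? c u

    size : ℕ
    size = S (λ u → 𝟙 (Coset? u))

    zeros : Point → ℕ
    zeros c = S (λ u → 𝟙 (CosetZero? c u))

    0<size : 0 < size
    0<size with u , u∈ ← columnGcd-attained c₀ =
      0<S (𝟙-periodic Coset? (shiftable-∣ (columnGcd c₀) c₀))
          (subst (0 <_) (sym (𝟙-yes (Coset? u) u∈)) z<s)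

    -- If c vanishes at a point p of the coset, then some w in the kernel of c₀
    -- has ⟨ c , w ⟩ of order `order c`, and the translates by the multiples of w
    -- of the zero set of c in the coset are disjoint.

    density : ∀ c → order c * zeros c ≤ size
    density c with S-nonZero (λ u → 𝟙 (CosetZero? c u))
    ... | inj₁ zeros≡0 =
      subst (_≤ size) (sym (trans (cong (order c *_) zeros≡0) (*-zeroʳ (order c)))) z≤n
    ... | inj₂ (p , ≢0)
      with p∈ , cp ← 𝟙≢0 (CosetZero? c p) ≢0
         | q , N∣d+cq ← columnGcd-attained c = begin
      order c * zeros c
        ≡⟨ ∑-const (order c) (zeros c) ⟨
      ∑[ i < order c ] zeros c
        ≡⟨ sum-cong-≗ {order c} (λ i → S-shift periodic (toℕ i ⊙ w)) ⟨
      ∑[ i < order c ] S (λ u → 𝟙 (CosetZero? c (toℕ i ⊙ w ⊕ u)))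
        ≡⟨ S-∑ (order c) (λ i u → 𝟙 (CosetZero? c (i ⊙ w ⊕ u))) ⟨
      S (λ u → ∑[ i < order c ] 𝟙 (CosetZero? c (toℕ i ⊙ w ⊕ u)))
        ≤⟨ S-mono disjoint ⟩
      size ∎
      where
      open ≤-Reasoning
      d₀∣ = columnGcd∣⟨⟩ c₀ q
      e = quotient d₀∣
      w = e ⊙ p ⊕ q

      periodic : Periodic (λ u → 𝟙 (CosetZero? c u))
      periodic = 𝟙-periodic (CosetZero? c) (shiftable-× (shiftable-∣ (columnGcd c₀) c₀) (shiftable-∣ 0 c))

      c₀w : Zero c₀ w
      c₀w = subst (N ∣_) eq (∣n⇒∣m*n e p∈)
        where
        eq : e * (columnGcd c₀ + ⟨ c₀ , p ⟩) ≡ ⟨ c₀ , w ⟩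
        eq = trans (*-distribˡ-+ e (columnGcd c₀) _)
          (trans (+-comm (e * columnGcd c₀) _) (trans (cong₂ _+_ (sym (⟨⟩-⊙ c₀ e p)) (sym (m∣n⇒n≡quotient*m d₀∣)))
            (sym (⟨⟩-⊕ c₀ (e ⊙ p) q))))

      N∣d+cw : N ∣ columnGcd c + ⟨ c , w ⟩
      N∣d+cw = Equivalence.from
        (∣+⟨⟩-shift (columnGcd c) c {e ⊙ p} (Zero-⊙ e c {p} (∣n⇒∣m*n e cp)) q) N∣d+cq

      separated : ∀ u {i j} → j < order c → Zero c (i ⊙ w ⊕ u) → Zero c (j ⊙ w ⊕ u) → i ≤ j → i ≡ j
      separated u {i} {j} j<k ci cj i≤j with j ∸ i in eq
      ... | zero    = ≤-antisym i≤j (m∸n≡0⇒m≤n eq)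
      ... | suc m   = contradiction (≤-trans (s≤s m<j) j<k) (≤⇒≯ (∣⇒≤ k∣m))
        where
        m<j : suc m ≤ j
        m<j = subst (_≤ j) eq (m∸n≤m j i)
        identity : ⟨ c , j ⊙ w ⊕ u ⟩ ≡ ⟨ c , i ⊙ w ⊕ u ⟩ + suc m * ⟨ c , w ⟩
        identity = begin-equality
          ⟨ c , j ⊙ w ⊕ u ⟩
            ≡⟨ value j ⟩
          j * ⟨ c , w ⟩ + ⟨ c , u ⟩
            ≡⟨ cong (λ n → n * ⟨ c , w ⟩ + ⟨ c , u ⟩) (trans (sym (m+[n∸m]≡n i≤j)) (cong (i +_) eq)) ⟩
          (i + suc m) * ⟨ c , w ⟩ + ⟨ c , u ⟩
            ≡⟨ ring i (suc m) ⟨ c , w ⟩ ⟨ c , u ⟩ ⟩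
          (i * ⟨ c , w ⟩ + ⟨ c , u ⟩) + suc m * ⟨ c , w ⟩
            ≡⟨ cong (_+ suc m * ⟨ c , w ⟩) (value i) ⟨
          ⟨ c , i ⊙ w ⊕ u ⟩ + suc m * ⟨ c , w ⟩ ∎
          where
          value : ∀ n → ⟨ c , n ⊙ w ⊕ u ⟩ ≡ n * ⟨ c , w ⟩ + ⟨ c , u ⟩
          value n = trans (⟨⟩-⊕ c (n ⊙ w) u) (cong (_+ ⟨ c , u ⟩) (⟨⟩-⊙ c n w))
          ring : ∀ i m w u → (i + m) * w + u ≡ (i * w + u) + m * w
          ring = solve-∀
        k∣m : order c ∣ suc m
        k∣m = kills⇒order∣ {u = w} c N∣d+cw (∣m+n∣m⇒∣n (subst (N ∣_) identity cj) ci)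

      disjoint : ∀ u → ∑[ i < order c ] 𝟙 (CosetZero? c (toℕ i ⊙ w ⊕ u)) ≤ 𝟙 (Coset? u)
      disjoint u = ∑𝟙≤𝟙 (λ i → CosetZero? c (toℕ i ⊙ w ⊕ u)) (Coset? u)
        (λ i (h , _) → Equivalence.to
          (∣+⟨⟩-shift (columnGcd c₀) c₀ {toℕ i ⊙ w} (Zero-⊙ (toℕ i) c₀ {w} (∣n⇒∣m*n (toℕ i) c₀w)) u) h)
        (λ i j (_ , ci) (_ , cj) → toℕ-injective
          ([ separated u (toℕ<n j) ci cj , (λ j≤i → sym (separated u (toℕ<n i) cj ci j≤i)) ]′
            (≤-total (toℕ i) (toℕ j))))

    Cover : List Point → Set
    Cover cs = ∀ u → Coset u → Any (λ c → Zero c u) cs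

    𝟙-covered : ∀ {cs} → Cover cs → ∀ u → 𝟙 (Coset? u) ≤ sum (map (λ c → 𝟙 (CosetZero? c u)) cs)
    𝟙-covered {cs₀} cover u with Coset? u in eq
    ... | no  _  = z≤n
    ... | yes u∈ = subst (λ C? → 1 ≤ sum (map (λ c → 𝟙 (C? ×-dec Zero? c u)) cs₀)) eq (one (cover u u∈))
      where
      one : ∀ {cs} → Any (λ c → Zero c u) cs → 1 ≤ sum (map (λ c → 𝟙 (CosetZero? c u)) cs)
      one {c ∷ cs} (here cu)  = ≤-trans (≤-reflexive (sym (𝟙-yes (CosetZero? c u) (u∈ , cu)))) (m≤m+n _ _)
      one {c ∷ cs} (there cu) = ≤-trans (one cu) (m≤n+m _ (𝟙 (CosetZero? c u)))

    zeros-bounds : ∀ {ls cs} → Pointwise (λ l c → l ≤ order c) ls cs →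
                   Pointwise (λ l n → l * n ≤ size) ls (map zeros cs)
    zeros-bounds []                         = []
    zeros-bounds {cs = c ∷ _} (l≤k ∷ ls≤ks) = ≤-trans (*-monoˡ-≤ (zeros c) l≤k) (density c) ∷ zeros-bounds ls≤ks

    sparse⇒¬cover : ∀ {ls cs} → Pointwise (λ l c → l ≤ order c) ls cs →
                    {True (num ls <? den ls)} → ¬ Cover cs
    sparse⇒¬cover {ls} {cs} ls≤ks {num<den} cover = <⇒≱
      (num<den⇒sum< {ls = ls} 0<size (zeros-bounds ls≤ks) (toWitness num<den))
      (subst (size ≤_) (S-sum (λ c u → 𝟙 (CosetZero? c u)) cs) (S-mono (𝟙-covered cover)))

    tight⇒disjoint : ∀ {ls c c′ cs} → Pointwise (λ l c → l ≤ order c) ls (c ∷ c′ ∷ cs) →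
                     {True (num ls ≤? den ls)} → .{{NonZero (den ls)}} → Cover (c ∷ c′ ∷ cs) →
                     ∀ {u} → Coset u → Zero c u → ¬ Zero c′ u
    tight⇒disjoint {ls} {c} {c′} {cs} ls≤ks {num≤den} cover {u} u∈ cu c′u = <⇒≱
      (≤-<-trans (num≤den⇒sum≤ {ls = ls} (zeros-bounds ls≤ks) (toWitness num≤den))
        (m<m+n size (0<S both-periodic (subst (0 <_) (sym (𝟙-yes (Both? u) (u∈ , cu , c′u))) z<s))))
      (begin
        size + S (λ u → 𝟙 (Both? u))
          ≡⟨ S-+ (λ u → 𝟙 (Coset? u)) (λ u → 𝟙 (Both? u)) ⟨
        S (λ u → 𝟙 (Coset? u) + 𝟙 (Both? u))
          ≤⟨ S-mono counted-twice ⟩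
        S (λ u → sum (map (λ c → 𝟙 (CosetZero? c u)) (c ∷ c′ ∷ cs)))
          ≡⟨ S-sum (λ c u → 𝟙 (CosetZero? c u)) (c ∷ c′ ∷ cs) ⟩
        sum (map zeros (c ∷ c′ ∷ cs)) ∎)
      where
      open ≤-Reasoning
      Both? : ∀ u → Dec (Coset u × Zero c u × Zero c′ u)
      Both? u = Coset? u ×-dec Zero? c u ×-dec Zero? c′ u
      both-periodic : Periodic (λ u → 𝟙 (Both? u))
      both-periodic = 𝟙-periodic Both? (shiftable-× (shiftable-∣ (columnGcd c₀) c₀)
        (shiftable-× (shiftable-∣ 0 c) (shiftable-∣ 0 c′)))
      counted-twice : ∀ u → 𝟙 (Coset? u) + 𝟙 (Both? u) ≤
                      sum (map (λ c → 𝟙 (CosetZero? c u)) (c ∷ c′ ∷ cs))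
      counted-twice u with Both? u
      ... | no _ = subst (_≤ sum (map (λ c → 𝟙 (CosetZero? c u)) (c ∷ c′ ∷ cs)))
                     (sym (+-identityʳ (𝟙 (Coset? u)))) (𝟙-covered cover u)
      ... | yes (u∈ , cu , c′u)
        rewrite 𝟙-yes (Coset? u) u∈ | 𝟙-yes (CosetZero? c u) (u∈ , cu) | 𝟙-yes (CosetZero? c′ u) (u∈ , c′u) =
        s≤s (s≤s z≤n)

  Balanced : List Point → Set
  Balanced cs = ∀ u → N ∣ sum (map (λ c → ⟨ c , u ⟩) cs)

  balanced-∣ : ∀ m xs c ys {u} → Balanced (xs ++ c ∷ ys) →
               All (λ c′ → N ∣ m * ⟨ c′ , u ⟩) (xs ++ ys) → N ∣ m * ⟨ c , u ⟩
  balanced-∣ m xs c ys {u} balanced others = ∣-cong-+ˡ m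
    (subst (N ∣_) (trans (sum-↭ (map⁺ (λ c → ⟨ c , u ⟩) (shift c xs ys))) (+-comm ⟨ c , u ⟩ _)) (balanced u))
    (∣m*sum (xs ++ ys) others)
    where
    ∣m*sum : ∀ cs → All (λ c′ → N ∣ m * ⟨ c′ , u ⟩) cs → N ∣ m * sum (map (λ c → ⟨ c , u ⟩) cs)
    ∣m*sum []       []       = subst (N ∣_) (sym (*-zeroʳ m)) (N ∣0)
    ∣m*sum (c ∷ cs) (h ∷ hs) = subst (N ∣_) (sym (*-distribˡ-+ m ⟨ c , u ⟩ _)) (∣m∣n⇒∣m+n h (∣m*sum cs hs))

  balanced-order∣ : ∀ {m} xs c ys → Balanced (xs ++ c ∷ ys) →
                    All (λ c′ → order c′ ∣ m) (xs ++ ys) → order c ∣ m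
  balanced-order∣ {m} xs c ys balanced others with u , N∣d+cu ← columnGcd-attained c =
    kills⇒order∣ c N∣d+cu (balanced-∣ m xs c ys balanced
      (All.map (λ {c′} k∣m → order∣⇒kills m c′ k∣m u) others))

  Reduced : List Point → Set
  Reduced cs = ∀ {m} → All (λ c → order c ∣ m) cs → N ∣ m

  module _ (c₀ c₁ c₂ c₃ c₄ : Point) (9≤N : 9 ≤ N)
           (balanced : Balanced (c₀ ∷ c₁ ∷ c₂ ∷ c₃ ∷ c₄ ∷ []))
           (reduced : Reduced (c₀ ∷ c₁ ∷ c₂ ∷ c₃ ∷ c₄ ∷ []))
           (cover : Cover c₀ (c₁ ∷ c₂ ∷ c₃ ∷ c₄ ∷ []))
           (k₁≤k₂ : order c₁ ≤ order c₂) (k₂≤k₃ : order c₂ ≤ order c₃) (k₃≤k₄ : order c₃ ≤ order c₄)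
    where

    exponent≥9 : ∀ m .{{_ : NonZero m}} → All (λ c → order c ∣ m) (c₀ ∷ c₁ ∷ c₂ ∷ c₃ ∷ c₄ ∷ []) →
                 {True (m <? 9)} → ⊥
    exponent≥9 m orders {m<9} = <⇒≱ (toWitness m<9) (≤-trans 9≤N (∣⇒≤ (reduced orders)))

    all≡4 : 4 ≤ order c₁ → order c₄ ≡ 4 → All (λ c → order c ≡ 4) (c₁ ∷ c₂ ∷ c₃ ∷ c₄ ∷ [])
    all≡4 k₁≥4 e₄ = e₁ ∷ e₂ ∷ e₃ ∷ e₄ ∷ []
      where
      e₃ = ≤-antisym (subst (order c₃ ≤_) e₄ k₃≤k₄) (≤-trans k₁≥4 (≤-trans k₁≤k₂ k₂≤k₃))
      e₂ = ≤-antisym (subst (order c₂ ≤_) e₃ k₂≤k₃) (≤-trans k₁≥4 k₁≤k₂)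
      e₁ = ≤-antisym (subst (order c₁ ≤_) e₂ k₁≤k₂) k₁≥4

    no-order-4 : order c₀ ≡ 4 → 5 ≤ order c₁ → ⊥
    no-order-4 _ k₁≥5 = sparse⇒¬cover c₀ {5 ∷ 5 ∷ 5 ∷ 5 ∷ []}
      (k₁≥5 ∷ k₂≥5 ∷ k₃≥5 ∷ ≤-trans k₃≥5 k₃≤k₄ ∷ []) cover
      where
      k₂≥5 = ≤-trans k₁≥5 k₁≤k₂
      k₃≥5 = ≤-trans k₂≥5 k₂≤k₃

    no-order-3 : order c₀ ≡ 3 → 4 ≤ order c₁ → ⊥
    no-order-3 e₀ k₁≥4 with ≤-split (≤-trans k₁≥4 (≤-trans k₁≤k₂ (≤-trans k₂≤k₃ k₃≤k₄)))
    ... | inj₁ k₄≥5 = sparse⇒¬cover c₀ {4 ∷ 4 ∷ 4 ∷ 5 ∷ []} (k₁≥4 ∷ k₂≥4 ∷ ≤-trans k₂≥4 k₂≤k₃ ∷ k₄≥5 ∷ []) cover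
      where k₂≥4 = ≤-trans k₁≥4 k₁≤k₂
    ... | inj₂ e₄   = not-at e₀ (balanced-order∣ {4} [] c₀ (c₁ ∷ c₂ ∷ c₃ ∷ c₄ ∷ []) balanced
      (All.map (λ e → at e) (all≡4 k₁≥4 e₄)))

    4*∣⇒Zero : ∀ {c u} → order c ≡ 3 → N ∣ 4 * ⟨ c , u ⟩ → Zero c u
    4*∣⇒Zero {c} {u} e h = ∣m+n∣m⇒∣n (subst (N ∣_) (+-comm ⟨ c , u ⟩ _) h) (order∣⇒kills 3 c (at e) u)

    orders≢2,3,3,4,4 : order c₀ ≡ 2 → order c₁ ≡ 3 → order c₂ ≡ 3 → order c₃ ≡ 4 → order c₄ ≡ 4 → ⊥
    orders≢2,3,3,4,4 e₀ e₁ e₂ e₃ e₄ = sparse⇒¬cover c₀ {3 ∷ 4 ∷ 4 ∷ []}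
      (≤-reflexive (sym e₁) ∷ ≤-reflexive (sym e₃) ∷ ≤-reflexive (sym e₄) ∷ []) cover′
      where
      c₂⇒c₁ : ∀ u → Zero c₂ u → Zero c₁ u
      c₂⇒c₁ u c₂u = 4*∣⇒Zero {c₁} e₁ (balanced-∣ 4 (c₀ ∷ []) c₁ (c₂ ∷ c₃ ∷ c₄ ∷ []) balanced
        (order∣⇒kills 4 c₀ (at e₀) u ∷ ∣n⇒∣m*n 4 c₂u ∷
         order∣⇒kills 4 c₃ (at e₃) u ∷ order∣⇒kills 4 c₄ (at e₄) u ∷ []))
      cover′ : Cover c₀ (c₁ ∷ c₃ ∷ c₄ ∷ [])
      cover′ u u∈ with cover u u∈
      ... | here c₁u         = here c₁u
      ... | there (here c₂u) = here (c₂⇒c₁ u c₂u)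
      ... | there (there c)  = there c

    orders≢2,3,4,4,6 : order c₀ ≡ 2 → order c₁ ≡ 3 → order c₂ ≡ 4 → order c₃ ≡ 4 → order c₄ ≡ 6 → ⊥
    orders≢2,3,4,4,6 e₀ e₁ e₂ e₃ e₄ = sparse⇒¬cover c₀ {3 ∷ 4 ∷ 4 ∷ []}
      (≤-reflexive (sym e₁) ∷ ≤-reflexive (sym e₂) ∷ ≤-reflexive (sym e₃) ∷ []) cover′
      where
      c₄⇒c₁ : ∀ u → Zero c₄ u → Zero c₁ u
      c₄⇒c₁ u c₄u = 4*∣⇒Zero {c₁} e₁ (balanced-∣ 4 (c₀ ∷ []) c₁ (c₂ ∷ c₃ ∷ c₄ ∷ []) balanced
        (order∣⇒kills 4 c₀ (at e₀) u ∷ order∣⇒kills 4 c₂ (at e₂) u ∷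
         order∣⇒kills 4 c₃ (at e₃) u ∷ ∣n⇒∣m*n 4 c₄u ∷ []))
      cover′ : Cover c₀ (c₁ ∷ c₂ ∷ c₃ ∷ [])
      cover′ u u∈ with cover u u∈
      ... | here c₁u                         = here c₁u
      ... | there (here c₂u)                 = there (here c₂u)
      ... | there (there (here c₃u))         = there (there (here c₃u))
      ... | there (there (there (here c₄u))) = here (c₄⇒c₁ u c₄u)

    -- 1/3 + 1/3 + 1/4 + 1/12 = 1, but three times a point of the coset is a common
    -- zero of c₁ and c₂ in the coset.

    orders≢2,3,3,4,≥12 : order c₀ ≡ 2 → order c₁ ≡ 3 → order c₂ ≡ 3 → order c₃ ≡ 4 → 12 ≤ order c₄ → ⊥
    orders≢2,3,3,4,≥12 e₀ e₁ e₂ e₃ k₄≥12 with x , x∈ ← columnGcd-attained c₀ =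
      tight⇒disjoint c₀ {3 ∷ 3 ∷ 4 ∷ 12 ∷ []}
        (≤-reflexive (sym e₁) ∷ ≤-reflexive (sym e₂) ∷ ≤-reflexive (sym e₃) ∷ k₄≥12 ∷ []) cover
        {3 ⊙ x} 3x∈ (Zero-⊙ 3 c₁ {x} (order∣⇒kills 3 c₁ (at e₁) x))
        (Zero-⊙ 3 c₂ {x} (order∣⇒kills 3 c₂ (at e₂) x))
      where
      d₀ = columnGcd c₀
      N∣2d₀ : N ∣ 2 * d₀
      N∣2d₀ = ∣-reflexive (trans (order*columnGcd c₀) (cong (_* d₀) e₀))
      ring : ∀ d t → 3 * (d + t) ≡ 2 * d + (d + 3 * t)
      ring = solve-∀
      3x∈ : Coset c₀ (3 ⊙ x)
      3x∈ = subst (λ t → N ∣ d₀ + t) (sym (⟨⟩-⊙ c₀ 3 x))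
        (∣m+n∣m⇒∣n (subst (N ∣_) (ring d₀ ⟨ c₀ , x ⟩) (∣n⇒∣m*n 3 x∈)) N∣2d₀)

    no-order-2 : order c₀ ≡ 2 → 3 ≤ order c₁ → ⊥
    no-order-2 e₀ k₁≥3 = case₁ (≤-split k₁≥3)
      where
      o₃ : ∀ {m} → order c₀ ∣ m → order c₁ ∣ m → order c₂ ∣ m → order c₄ ∣ m → order c₃ ∣ m
      o₃ h₀ h₁ h₂ h₄ = balanced-order∣ (c₀ ∷ c₁ ∷ c₂ ∷ []) c₃ (c₄ ∷ []) balanced (h₀ ∷ h₁ ∷ h₂ ∷ h₄ ∷ [])
      o₄ : ∀ {m} → order c₀ ∣ m → order c₁ ∣ m → order c₂ ∣ m → order c₃ ∣ m → order c₄ ∣ m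
      o₄ h₀ h₁ h₂ h₃ = balanced-order∣ (c₀ ∷ c₁ ∷ c₂ ∷ c₃ ∷ []) c₄ [] balanced (h₀ ∷ h₁ ∷ h₂ ∷ h₃ ∷ [])

      sparse : ∀ l₁ l₂ l₃ l₄ → let ls = l₁ ∷ l₂ ∷ l₃ ∷ l₄ ∷ [] in
               l₁ ≤ order c₁ → l₂ ≤ order c₂ → l₃ ≤ order c₃ → l₄ ≤ order c₄ →
               {True (num ls <? den ls)} → ⊥
      sparse _ _ _ _ h₁ h₂ h₃ h₄ {p} = sparse⇒¬cover c₀ (h₁ ∷ h₂ ∷ h₃ ∷ h₄ ∷ []) {p} cover

      case-334 : order c₁ ≡ 3 → order c₂ ≡ 3 → order c₃ ≡ 4 → 4 ≤ order c₄ → ⊥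
      case-334 e₁ e₂ e₃ k₄≥4 = split₄ (≤-split k₄≥4)
        where
        k₄∣12 : order c₄ ∣ 12
        k₄∣12 = o₄ (at e₀) (at e₁) (at e₂) (at e₃)
        split₇ : 7 ≤ order c₄ → 12 ≤ order c₄
        split₇ k₄≥7 = ≤-reflexive (∣∧<2*⇒≡ k₄∣12 (≤-trans (toWitness {a? = 12 <? 14} _) (*-monoʳ-≤ 2 k₄≥7)))
        split₆ : 7 ≤ order c₄ ⊎ order c₄ ≡ 6 → ⊥
        split₆ (inj₂ e₄) = not-at e₃ (o₃ {6} (at e₀) (at e₁) (at e₂) (at e₄))
        split₆ (inj₁ k₄≥7) = orders≢2,3,3,4,≥12 e₀ e₁ e₂ e₃ (split₇ k₄≥7)
        split₅ : 6 ≤ order c₄ ⊎ order c₄ ≡ 5 → ⊥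
        split₅ (inj₂ e₄) = not-at e₄ k₄∣12
        split₅ (inj₁ k₄≥6) = split₆ (≤-split k₄≥6)
        split₄ : 5 ≤ order c₄ ⊎ order c₄ ≡ 4 → ⊥
        split₄ (inj₂ e₄) = orders≢2,3,3,4,4 e₀ e₁ e₂ e₃ e₄
        split₄ (inj₁ k₄≥5) = split₅ (≤-split k₄≥5)

      case-335 : order c₁ ≡ 3 → order c₂ ≡ 3 → order c₃ ≡ 5 → 5 ≤ order c₄ → ⊥
      case-335 e₁ e₂ e₃ k₄≥5 with ≤-split k₄≥5
      ... | inj₂ e₄ = not-at e₀ (balanced-order∣ {15} [] c₀ (c₁ ∷ c₂ ∷ c₃ ∷ c₄ ∷ []) balanced
                        (at e₁ ∷ at e₂ ∷ at e₃ ∷ at e₄ ∷ []))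
      ... | inj₁ k₄≥6 with ≤-split k₄≥6
      ...   | inj₂ e₄ = not-at e₃ (o₃ {6} (at e₀) (at e₁) (at e₂) (at e₄))
      ...   | inj₁ k₄≥7 with ≤-split k₄≥7
      ...     | inj₂ e₄ = not-at e₃ (o₃ {42} (at e₀) (at e₁) (at e₂) (at e₄))
      ...     | inj₁ k₄≥8 = sparse 3 3 5 8 k₁≥3 (≤-reflexive (sym e₂)) (≤-reflexive (sym e₃)) k₄≥8

      case-33 : order c₁ ≡ 3 → order c₂ ≡ 3 → 3 ≤ order c₃ → ⊥
      case-33 e₁ e₂ k₃≥3 with ≤-split k₃≥3
      ... | inj₂ e₃ = exponent≥9 6 (at e₀ ∷ at e₁ ∷ at e₂ ∷ at e₃ ∷ o₄ (at e₀) (at e₁) (at e₂) (at e₃) ∷ [])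
      ... | inj₁ k₃≥4 with ≤-split k₃≥4
      ...   | inj₂ e₃ = case-334 e₁ e₂ e₃ (≤-trans k₃≥4 k₃≤k₄)
      ...   | inj₁ k₃≥5 with ≤-split k₃≥5
      ...     | inj₂ e₃ = case-335 e₁ e₂ e₃ (≤-trans k₃≥5 k₃≤k₄)
      ...     | inj₁ k₃≥6 with ≤-split k₃≥6 | ≤-split (≤-trans k₃≥6 k₃≤k₄)
      ...       | inj₂ e₃ | inj₂ e₄ = exponent≥9 6 (at e₀ ∷ at e₁ ∷ at e₂ ∷ at e₃ ∷ at e₄ ∷ [])
      ...       | _       | inj₁ k₄≥7 = sparse 3 3 6 7 k₁≥3 (≤-reflexive (sym e₂)) k₃≥6 k₄≥7
      ...       | inj₁ k₃≥7 | inj₂ e₄ = <⇒≱ (≤-trans k₃≥7 k₃≤k₄) (≤-reflexive e₄)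

      case-34 : order c₁ ≡ 3 → order c₂ ≡ 4 → 4 ≤ order c₃ → ⊥
      case-34 e₁ e₂ k₃≥4 with ≤-split k₃≥4
      ... | inj₁ k₃≥5 = sparse 3 4 5 5 k₁≥3 (≤-reflexive (sym e₂)) k₃≥5 (≤-trans k₃≥5 k₃≤k₄)
      ... | inj₂ e₃ with ≤-split (≤-trans k₃≥4 k₃≤k₄)
      ...   | inj₂ e₄ = not-at e₁ (balanced-order∣ {4} (c₀ ∷ []) c₁ (c₂ ∷ c₃ ∷ c₄ ∷ []) balanced
                          (at e₀ ∷ at e₂ ∷ at e₃ ∷ at e₄ ∷ []))
      ...   | inj₁ k₄≥5 with ≤-split k₄≥5
      ...     | inj₂ e₄ = not-at e₄ (o₄ {12} (at e₀) (at e₁) (at e₂) (at e₃))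
      ...     | inj₁ k₄≥6 with ≤-split k₄≥6
      ...       | inj₂ e₄ = orders≢2,3,4,4,6 e₀ e₁ e₂ e₃ e₄
      ...       | inj₁ k₄≥7 = sparse 3 4 4 7 k₁≥3 (≤-reflexive (sym e₂)) k₃≥4 k₄≥7

      case-3 : order c₁ ≡ 3 → 3 ≤ order c₂ → ⊥
      case-3 e₁ k₂≥3 with ≤-split k₂≥3
      ... | inj₂ e₂ = case-33 e₁ e₂ (≤-trans k₂≥3 k₂≤k₃)
      ... | inj₁ k₂≥4 with ≤-split k₂≥4
      ...   | inj₂ e₂ = case-34 e₁ e₂ (≤-trans k₂≥4 k₂≤k₃)
      ...   | inj₁ k₂≥5 = sparse 3 5 5 5 k₁≥3 k₂≥5 k₃≥5 (≤-trans k₃≥5 k₃≤k₄)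
        where k₃≥5 = ≤-trans k₂≥5 k₂≤k₃

      case₁ : 4 ≤ order c₁ ⊎ order c₁ ≡ 3 → ⊥
      case₁ (inj₂ e₁) = case-3 e₁ (≤-trans k₁≥3 k₁≤k₂)
      case₁ (inj₁ k₁≥4) with ≤-split (≤-trans k₁≥4 (≤-trans k₁≤k₂ (≤-trans k₂≤k₃ k₃≤k₄)))
      ... | inj₁ k₄≥5 = sparse 4 4 4 5 k₁≥4 k₂≥4 (≤-trans k₂≥4 k₂≤k₃) k₄≥5
        where k₂≥4 = ≤-trans k₁≥4 k₁≤k₂
      ... | inj₂ e₄ = exponent≥9 4 (at e₀ ∷ All.map (λ e → at e) (all≡4 k₁≥4 e₄))

  orderOrder : DecTotalOrder _ _ _
  orderOrder = On.decTotalOrder ≤-decTotalOrder order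

  open Data.List.Sort orderOrder using (sort; sort-↭; sort-↗)
  open Data.List.Relation.Unary.Sorted.TotalOrder (DecTotalOrder.totalOrder orderOrder) using (Sorted)

  sorted-uncovered : ∀ {α c₀ cs} → 9 ≤ N → α ≡ 2 ⊎ α ≡ 3 ⊎ α ≡ 4 → length cs ≡ 4 → Sorted cs →
                     order c₀ ≡ α → All (λ c → α < order c) cs →
                     Balanced (c₀ ∷ cs) → Reduced (c₀ ∷ cs) → ¬ Cover c₀ cs
  sorted-uncovered {c₀ = c₀} {c₁ ∷ c₂ ∷ c₃ ∷ c₄ ∷ []} 9≤N α∈ refl (k₁≤k₂ ∷ k₂≤k₃ ∷ k₃≤k₄ ∷ [-])
                   e₀ (α<k₁ ∷ _) balanced reduced cover = by-order α∈ e₀ α<k₁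
    where
    by-order : ∀ {α} → α ≡ 2 ⊎ α ≡ 3 ⊎ α ≡ 4 → order c₀ ≡ α → α < order c₁ → ⊥
    by-order (inj₁ refl)        = no-order-2 c₀ c₁ c₂ c₃ c₄ 9≤N balanced reduced cover k₁≤k₂ k₂≤k₃ k₃≤k₄
    by-order (inj₂ (inj₁ refl)) = no-order-3 c₀ c₁ c₂ c₃ c₄ 9≤N balanced reduced cover k₁≤k₂ k₂≤k₃ k₃≤k₄
    by-order (inj₂ (inj₂ refl)) = no-order-4 c₀ c₁ c₂ c₃ c₄ 9≤N balanced reduced cover k₁≤k₂ k₂≤k₃ k₃≤k₄

  Balanced-resp-↭ : ∀ {cs ds} → cs ↭ ds → Balanced cs → Balanced ds
  Balanced-resp-↭ cs↭ds balanced u = subst (N ∣_) (sum-↭ (map⁺ (λ c → ⟨ c , u ⟩) cs↭ds)) (balanced u)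

  Reduced-resp-↭ : ∀ {cs ds} → cs ↭ ds → Reduced cs → Reduced ds
  Reduced-resp-↭ cs↭ds reduced orders = reduced (All-resp-↭ (↭-sym cs↭ds) orders)

  uncovered : ∀ {α c₀ cs} → 9 ≤ N → α ≡ 2 ⊎ α ≡ 3 ⊎ α ≡ 4 → length cs ≡ 4 →
              order c₀ ≡ α → All (λ c → α < order c) cs →
              Balanced (c₀ ∷ cs) → Reduced (c₀ ∷ cs) → ¬ Cover c₀ cs
  uncovered {c₀ = c₀} {cs} 9≤N α∈ length≡4 e₀ orders balanced reduced cover =
    sorted-uncovered 9≤N α∈ (trans (↭-length (sort-↭ cs)) length≡4) (sort-↗ cs)
      e₀ (All-resp-↭ cs↭ orders) (Balanced-resp-↭ (prep c₀ cs↭) balanced)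
      (Reduced-resp-↭ (prep c₀ cs↭) reduced) (λ u u∈ → Any-resp-↭ cs↭ (cover u u∈))
    where cs↭ = ↭-sym (sort-↭ cs)

  nonzero-on-coset : ∀ {c₀ u} → 1 < order c₀ → Coset c₀ u → ¬ Zero c₀ u
  nonzero-on-coset {c₀} 1<k u∈ c₀u = <⇒≱ 1<k (∣⇒≤ (*-cancelʳ-∣ (columnGcd c₀) {{columnGcd-nonZero c₀}}
    (subst₂ _∣_ (order*columnGcd c₀) (sym (*-identityˡ _))
      (∣m+n∣m⇒∣n (subst (N ∣_) (+-comm (columnGcd c₀) _) u∈) c₀u))))

  toℕ-mod : ∀ m → toℕ (m mod N) ≡ m % N
  toℕ-mod m = toℕ-fromℕ< (m%n<n m N)

  toℕ-0ₙ : toℕ (0ₙ {N}) ≡ 0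
  toℕ-0ₙ = trans (toℕ-mod 0) (n∣m⇒m%n≡0 0 N (N ∣0))

  %-*-absorbˡ : ∀ a x → (a % N * x) % N ≡ (a * x) % N
  %-*-absorbˡ a x = trans (%-distribˡ-* (a % N) x N)
    (trans (cong (λ t → (t * (x % N)) % N) (m%n%n≡m%n a N)) (sym (%-distribˡ-* a x N)))

  span-∣ : ∀ {m n d} {g : Matrix N m n} → d ∣ N → (∀ k i → d ∣ toℕ (entry g k i)) →
           ∀ {w} → Span g w → ∀ i → d ∣ toℕ (lookup w i)
  span-∣ {d = d} {g} d∣N d∣g = go
    where
    go : ∀ {w} → Span g w → ∀ i → d ∣ toℕ (lookup w i)
    go (row k) i = d∣g k i
    go zero    i = subst (d ∣_) (sym (trans (cong toℕ (lookup-replicate i 0ₙ)) toℕ-0ₙ)) (d ∣0)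
    go (plus {v} {w} v∈ w∈) i =
      subst (d ∣_) (sym (trans (cong toℕ (lookup-zipWith _+ₙ_ i v w)) (toℕ-mod _)))
        (%-presˡ-∣ (∣m∣n⇒∣m+n (go v∈ i) (go w∈ i)) d∣N)
    go (scale c {w} w∈) i =
      subst (d ∣_) (sym (trans (cong toℕ (lookup-map i (c *ₙ_) w)) (toℕ-mod _)))
        (%-presˡ-∣ (∣n⇒∣m*n (toℕ c) (go w∈ i)) d∣N)

  column : ∀ {n} → Matrix N 2 n → Fin n → Point
  column g i = point (toℕ (entry g zero i)) (toℕ (entry g (suc zero) i))

  combination : ∀ {n} (g : Matrix N 2 n) u →
                ∃[ w ] Span g w × (∀ i → toℕ (lookup w i) ≡ ⟨ column g i , u ⟩ % N)
  combination g (point a b) =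
    _ , plus (scale (a mod N) (row zero)) (scale (b mod N) (row (suc zero))) , value
    where
    summand : ∀ a k i → toℕ (lookup (Vec.map ((a mod N) *ₙ_) (lookup g k)) i) ≡ (a * toℕ (entry g k i)) % N
    summand a k i = begin
      toℕ (lookup (Vec.map ((a mod N) *ₙ_) (lookup g k)) i)  ≡⟨ cong toℕ (lookup-map i _ (lookup g k)) ⟩
      toℕ ((a mod N) *ₙ entry g k i)                         ≡⟨ toℕ-mod _ ⟩
      (toℕ (a mod N) * toℕ (entry g k i)) % N                ≡⟨ cong (λ t → (t * toℕ (entry g k i)) % N) (toℕ-mod a) ⟩
      (a % N * toℕ (entry g k i)) % N                        ≡⟨ %-*-absorbˡ a _ ⟩
      (a * toℕ (entry g k i)) % N                            ∎
      where open ≡-Reasoning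
    value : ∀ i → _ ≡ ⟨ column g i , point a b ⟩ % N
    value i = trans (cong toℕ (lookup-zipWith _+ₙ_ i (Vec.map ((a mod N) *ₙ_) (lookup g zero)) _))
      (trans (toℕ-mod _) (trans (cong₂ (λ s t → (s + t) % N) (summand a zero i) (summand b (suc zero) i))
        (sym (%-distribˡ-+ (a * toℕ (entry g zero i)) _ N))))

  thin⇒Any-Zero : ∀ {n} (g : Matrix N 2 n) → Thin (codeGeneratedBy g) →
                  ∀ u → Any (λ c → Zero c u) (tabulate (column g))
  thin⇒Any-Zero {n} g thin u with w , w∈ , value ← combination g u
    with i , ¬≢0 ← ¬∀⟶∃¬ n (λ i → lookup w i ≢ 0ₙ) (λ i → ¬? (lookup w i ≟ 0ₙ))
                     (Thin.noNowhereZero thin w∈) =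
    Any.tabulate⁺ i (m%n≡0⇒n∣m _ N
      (trans (sym (value i)) (trans (cong toℕ (decidable-stable (lookup w i ≟ 0ₙ) ¬≢0)) toℕ-0ₙ)))

  extended⇒Balanced : (g : Matrix N 2 5) → Extended (codeGeneratedBy g) → Balanced (tabulate (column g))
  extended⇒Balanced ((x₀ ∷ x₁ ∷ x₂ ∷ x₃ ∷ x₄ ∷ []) ∷ (y₀ ∷ y₁ ∷ y₂ ∷ y₃ ∷ y₄ ∷ []) ∷ [])
                    extended (point a b) =
    subst (N ∣_) (ring a b (toℕ x₀) (toℕ x₁) (toℕ x₂) (toℕ x₃) (toℕ x₄)
                        (toℕ y₀) (toℕ y₁) (toℕ y₂) (toℕ y₃) (toℕ y₄))
      (∣m∣n⇒∣m+n (∣n⇒∣m*n a (extended (row zero))) (∣n⇒∣m*n b (extended (row (suc zero)))))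
    where
    ring : ∀ a b x₀ x₁ x₂ x₃ x₄ y₀ y₁ y₂ y₃ y₄ →
      a * (x₀ + (x₁ + (x₂ + (x₃ + (x₄ + 0))))) + b * (y₀ + (y₁ + (y₂ + (y₃ + (y₄ + 0))))) ≡
      (a * x₀ + b * y₀) + ((a * x₁ + b * y₁) + ((a * x₂ + b * y₂) +
        ((a * x₃ + b * y₃) + ((a * x₄ + b * y₄) + 0))))
    ring = solve-∀

  admissible⇒Reduced : ∀ {n} (g : Matrix N 2 n) → Admissible (codeGeneratedBy g) →
                       Reduced (tabulate (column g))
  admissible⇒Reduced g admissible {m} orders = subst (_∣ m) (sym N≡h) (gcd[m,n]∣n N m)
    where
    h = gcd N m
    h∣N : h ∣ N
    h∣N = gcd[m,n]∣m N m
    q = quotient h∣N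
    N≡q*h : N ≡ q * h
    N≡q*h = m∣n⇒n≡quotient*m h∣N
    h≢0 : NonZero h
    h≢0 = ≢-nonZero λ h≡0 → ≢-nonZero⁻¹ N (trans N≡q*h (trans (cong (q *_) h≡0) (*-zeroʳ q)))
    N∣m* : ∀ k i → N ∣ m * toℕ (entry g k i)
    N∣m* zero       i = subst (λ t → N ∣ m * t) (trans (+-identityʳ _) (*-identityˡ _))
      (order∣⇒kills m (column g i) (All.tabulate⁻ orders i) (point 1 0))
    N∣m* (suc zero) i = subst (λ t → N ∣ m * t) (*-identityˡ _)
      (order∣⇒kills m (column g i) (All.tabulate⁻ orders i) (point 0 1))
    q∣g : ∀ k i → q ∣ toℕ (entry g k i)
    q∣g k i = *-cancelʳ-∣ h {{h≢0}}
      (subst₂ _∣_ N≡q*h (sym (c*gcd[m,n]≡gcd[cm,cn] x N m))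
        (gcd-greatest (n∣m*n x) (subst (N ∣_) (*-comm m x) (N∣m* k i))))
      where x = toℕ (entry g k i)
    q∣1 : q ∣ 1
    q∣1 = proj₂ (Admissible.gcd≡1 admissible) λ where
      (inj₁ refl)              → quotient-∣ h∣N
      (inj₂ (_ , i , w∈ , refl)) → span-∣ (quotient-∣ h∣N) q∣g w∈ i
    N≡h : N ≡ h
    N≡h = trans N≡q*h (trans (cong (_* h) (∣1⇒≡1 q∣1)) (*-identityˡ h))

tabulate-punchIn-↭ : ∀ {A : Set} (f : Fin 5 → A) i → tabulate f ↭ f i ∷ tabulate (f ∘ punchIn i)
tabulate-punchIn-↭ f zero                         = ↭-refl
tabulate-punchIn-↭ f (suc zero)                   = shift _ (f zero ∷ []) _
tabulate-punchIn-↭ f (suc (suc zero))             = shift _ (f zero ∷ f (suc zero) ∷ []) _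
tabulate-punchIn-↭ f (suc (suc (suc zero)))       = shift _ (f zero ∷ f (suc zero) ∷ f (suc (suc zero)) ∷ []) _
tabulate-punchIn-↭ f (suc (suc (suc (suc zero)))) =
  shift _ (f zero ∷ f (suc zero) ∷ f (suc (suc zero)) ∷ f (suc (suc (suc zero))) ∷ []) _

lemma3p6 : (N : ℕ) .{{_ : NonZero N}} → 9 ≤ N →
    (α : ℕ) → (α ≡ 2 ⊎ α ≡ 3 ⊎ α ≡ 4) → (α∣N : α ∣ N) →
    let M = quotient α∣N in
    (g : Matrix N 2 5) → Admissible (codeGeneratedBy g) →
    (∃[ i ] columnGCD g i ≡ M × (∀ (j : Fin 5) → j ≢ i → columnGCD g j < M)) →
    ¬ (∃[ i ] ZeroColumn g i) →
    ¬ Thin (codeGeneratedBy g)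
lemma3p6 N 9≤N α α∈ α∣N g admissible (i , d≡M , d<M) _ thin =
  uncovered N 9≤N α∈ refl order≡α orders>α
    (Balanced-resp-↭ N columns↭ (extended⇒Balanced N g (Admissible.extended admissible)))
    (Reduced-resp-↭ N columns↭ (admissible⇒Reduced N g admissible))
    cover
  where
  M = quotient α∣N
  c = column N g
  columns↭ = tabulate-punchIn-↭ c i

  2≤α : ∀ {α} → α ≡ 2 ⊎ α ≡ 3 ⊎ α ≡ 4 → 2 ≤ α
  2≤α (inj₁ refl)        = s≤s (s≤s z≤n)
  2≤α (inj₂ (inj₁ refl)) = s≤s (s≤s z≤n)
  2≤α (inj₂ (inj₂ refl)) = s≤s (s≤s z≤n)

  order≡α : order N (c i) ≡ α
  order≡α = *-cancelʳ-≡ _ _ M {{quotient≢0 α∣N}}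
    (trans (cong (order N (c i) *_) (sym d≡M)) 
      (trans (sym (order*columnGcd N (c i))) (m∣n⇒n≡m*quotient α∣N)))

  order>α : ∀ j → j ≢ i → α < order N (c j)
  order>α j j≢i = ≰⇒> λ k≤α → <-irrefl refl (begin-strict
    N                                 ≡⟨ order*columnGcd N (c j) ⟩
    order N (c j) * columnGcd N (c j) ≤⟨ *-monoˡ-≤ (columnGcd N (c j)) k≤α ⟩
    α * columnGcd N (c j)             <⟨ *-monoʳ-< α {{>-nonZero (<⇒≤ (2≤α α∈))}} (d<M j j≢i) ⟩
    α * M                             ≡⟨ m∣n⇒n≡m*quotient α∣N ⟨
    N                                 ∎)
    where open ≤-Reasoning

  orders>α : All (λ c → α < order N c) (tabulate (c ∘ punchIn i))
  orders>α = All.tabulate⁺ {f = c ∘ punchIn i} λ j → order>α (punchIn i j) (punchInᵢ≢i i j)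

  cover : Cover N (c i) (tabulate (c ∘ punchIn i))
  cover u u∈ with Any-resp-↭ columns↭ (thin⇒Any-Zero N g thin u)
  ... | here  cᵢu = contradiction cᵢu
    (nonzero-on-coset N {c i} {u} (subst (1 <_) (sym order≡α) (2≤α α∈)) u∈)
  ... | there zs  = zs
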